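{- Let $\Sigma$ be a finite alphabet. The constraint system $\mathbb L_2$ over $\Sigma$, ordered by the entailment relation $\preceq$, is a better quasi-ordering.
   Context: For words $w_1,w_2\in\Sigma^*$, $w_1\preceq_w w_2$ means that $w_1$ is a (not necessarily contiguous) subword of $w_2$. The constraint system $\mathbb L_2$ is the smallest set of expressions, with denotations $[\![\cdot]\!]\subseteq\Sigma^*$, such that: - $a\in\mathbb L_2$ for each $a\in\Sigma$, with $[\![a]\!]=\{w\mid a\preceq_w w\}$; - (concatenation) if $\phi_1,\phi_2\in\mathbb L_2$ then $\phi_1\bullet\phi_2\in\mathbb L_2$, with $[\![\phi_1\bullet\phi_2]\!]=\{w_1w_2\mid w_1\in[\![\phi_1]\!]\text{ and }w_2\in[\![\phi_2]\!]\}$; - (conjunction) if $\phi_1,\phi_2\in\mathbb L_2$ then $\phi_1\,\&\,\phi_2\in\mathbb L_2$, with $[\![\phi_1\,\&\,\phi_2]\!]=[\![\phi_1]\!]\cap[\![\phi_2]\!]$; - (disjunction) if $\phi_1,\phi_2\in\mathbb L_2$ then $\phi_1+\phi_2\in\mathbb L_2$, with $[\![\phi_1+\phi_2]\!]=[\![\phi_1]\!]\cup[\![\phi_2]\!]$. Entailment: $\phi_1\preceq\phi_2$ iff $[\![\phi_2]\!]\subseteq[\![\phi_1]\!]$. Better quasi-orderings: let $\mathcal N=\{0,1,2,\dots\}$ and let $\mathcal N^{<\omega}$ (resp. $\mathcal N^{\omega}$) be the set of finite (resp. infinite) strictly increasing sequences over $\mathcal N$. For $s\in\mathcal N^{<\omega}$,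 $\lambda(s)$ is the set of numbers occurring in $s$, and if $s$ is nonempty, $tail(s)$ is $s$ with its first element deleted. $s_1\ll s_2$ means $s_1$ is a proper prefix of $s_2$; for nonempty $s_1$, $s_1\ll_* s_2$ means $tail(s_1)\ll s_2$. An infinite set $\beta\subseteq\mathcal N^{<\omega}$ is a barrier if (i) there are no $s_1,s_2\in\beta$ with $\lambda(s_1)\subsetneq\lambda(s_2)$, and (ii) for each $s_2\in\mathcal N^\omega$ there is $s_1\in\beta$ with $s_1\ll s_2$. A quasi-ordering (reflexive transitive relation) $(A,\preceq)$ is a better quasi-ordering if for every barrier $\beta$ and every map $f:\beta\to A$ there are $s_1,s_2\in\beta$ with $s_1\ll_* s_2$ and $f(s_1)\preceq f(s_2)$. -}

module Defs where

open import Data.Empty using (⊥)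
open import Data.List.Base using (List; []; _∷_; [_]; _++_; length; applyUpTo)
open import Data.List.Membership.Propositional using () renaming (_∈_ to _∈ₗ_)
open import Data.List.Relation.Binary.Prefix.Heterogeneous using (Prefix)
open import Data.List.Relation.Binary.Sublist.Propositional using () renaming (_⊆_ to _≼ʷ_)
open import Data.List.Relation.Unary.Linked using (Linked)
open import Data.Nat.Base using (ℕ; _<_)
open import Data.Product.Base using (∃; ∃₂; _×_; proj₁)
open import Level using (0ℓ)
open import Relation.Binary.Core using (Rel; _Preserves_⟶_)
open import Relation.Binary.PropositionalEquality.Core using (_≡_; _≢_)
open import Relation.Binary.Structures using (IsPreorder)
open import Relation.Nullary.Negation.Core using (¬_)
open import Relation.Unary using (Pred; _∈_; _⊆_; _⊂_; _∩_; _∪_)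

infixl 8 _•_
infixl 7 _&_
infixl 6 _+_

data 𝕃₂ (Σ : Set) : Set where
  atom : Σ → 𝕃₂ Σ
  _•_  : 𝕃₂ Σ → 𝕃₂ Σ → 𝕃₂ Σ
  _&_  : 𝕃₂ Σ → 𝕃₂ Σ → 𝕃₂ Σ
  _+_  : 𝕃₂ Σ → 𝕃₂ Σ → 𝕃₂ Σ

⟦_⟧ : ∀ {Σ} → 𝕃₂ Σ → Pred (List Σ) 0ℓ
⟦ atom a  ⟧ = λ w → [ a ] ≼ʷ w
⟦ φ₁ • φ₂ ⟧ = λ w → ∃₂ λ w₁ w₂ → w ≡ w₁ ++ w₂ × w₁ ∈ ⟦ φ₁ ⟧ × w₂ ∈ ⟦ φ₂ ⟧
⟦ φ₁ & φ₂ ⟧ = ⟦ φ₁ ⟧ ∩ ⟦ φ₂ ⟧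
⟦ φ₁ + φ₂ ⟧ = ⟦ φ₁ ⟧ ∪ ⟦ φ₂ ⟧

infix 4 _≼_ _≪_ _≪*_ _≪ω_

_≼_ : ∀ {Σ} → Rel (𝕃₂ Σ) 0ℓ
φ₁ ≼ φ₂ = ⟦ φ₂ ⟧ ⊆ ⟦ φ₁ ⟧

_≪_ : Rel (List ℕ) 0ℓ
s₁ ≪ s₂ = Prefix _≡_ s₁ s₂ × s₁ ≢ s₂

-- The tail of the empty sequence is undefined, so [] is related to nothing.
_≪*_ : Rel (List ℕ) 0ℓ
[]      ≪* s₂ = ⊥
(_ ∷ t) ≪* s₂ = t ≪ s₂

-- An infinite sequence is a function on ℕ; any finite prefix of it is proper.
_≪ω_ : List ℕ → (ℕ → ℕ) → Set
s ≪ω σ = s ≡ applyUpTo σ (length s)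

values : List ℕ → Pred ℕ 0ℓ
values s = λ n → n ∈ₗ s

Infinite : ∀ {A : Set} → Pred A 0ℓ → Set
Infinite P = ¬ (∃ λ xs → ∀ x → x ∈ P → x ∈ₗ xs)

record Barrier (β : Pred (List ℕ) 0ℓ) : Set where
  field
    increasing : β ⊆ Linked _<_
    infinite   : Infinite β
    antichain  : ∀ {s₁ s₂} → s₁ ∈ β → s₂ ∈ β → ¬ (values s₁ ⊂ values s₂)
    meets      : ∀ (σ : ℕ → ℕ) → σ Preserves _<_ ⟶ _<_ → ∃ λ s → s ∈ β × s ≪ω σ

record IsBetterQuasiOrder {A : Set} (_≲_ : Rel A 0ℓ) : Set₁ where
  field
    isPreorder : IsPreorder _≡_ _≲_
    good       : ∀ (β : Pred (List ℕ) 0ℓ) → Barrier β → (f : ∃ β → A) →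
                 ∃₂ λ p q → proj₁ p ≪* proj₁ q × f p ≲ f q

{-# OPTIONS --safe #-}
module Submission where

-- Denotations are upward closed under the subword order.  Hence if φ ↦ ⟦φ⟧ is bad along s ◁ t, a word in
-- ⟦f t⟧ but not in ⟦f s⟧ can be attached to s ∪ t, and these words form a bad array indexed by { s ∪ t ∣ s ◁ t }.
-- So it is enough that no array of words over a finite alphabet is bad, which follows Nash-Williams: among the
-- bad arrays on a fixed index set there is one, restricted to some infinite set, whose values cannot be
-- shortened.  By the partition theorem for barriers its values have, on a smaller infinite set, a constant
-- first letter; deleting that letter there leaves the array bad and shortens it.

open import Axiom.ExcludedMiddle using (ExcludedMiddle)
open import Data.Bool.Base using (Bool; true; T)
open import Data.Empty using (⊥; ⊥-elim)
open import Data.Fin.Base using (Fin; zero; suc)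
import Data.Fin.Properties as Fin
open import Data.List.Base using (List; []; _∷_; [_]; _++_; length; applyUpTo; head; drop; map)
open import Data.List.Extrema.Nat using (max; xs≤max)
open import Data.List.Membership.Propositional using () renaming (_∈_ to _∈ₗ_)
open import Data.List.Membership.Propositional.Properties using (∈-++⁺ˡ; ∈-++⁺ʳ; ∈-map⁺)
open import Data.List.Properties using (∷-injective; applyUpTo-∷ʳ; ++-assoc; ++-identityʳ)
open import Data.List.Relation.Binary.Equality.Propositional using (≋⇒≡)
open import Data.List.Relation.Binary.Prefix.Heterogeneous using ([]; _∷_)
open import Data.List.Relation.Binary.Sublist.Propositional
  using ([]; _∷_; _∷ʳ_; ⊆-refl; ⊆-reflexive; ⊆-trans; minimum) renaming (_⊆_ to _≼ʷ_)
open import Data.List.Relation.Binary.Sublist.Propositional.Properties using (length-mono-≤; to-≋; drop-⊆)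
open import Data.List.Relation.Unary.All as All using (All; []; _∷_)
import Data.List.Relation.Unary.All.Properties as All
open import Data.List.Relation.Unary.AllPairs as AllPairs using (AllPairs; []; _∷_)
import Data.List.Relation.Unary.AllPairs.Properties as AllPairs
open import Data.List.Relation.Unary.Any using (Any; here; there)
import Data.List.Relation.Unary.Any.Properties as Any
open import Data.List.Relation.Unary.Linked.Properties using (Linked⇒AllPairs)
open import Data.Maybe.Base using (Maybe; just; nothing)
open import Data.Maybe.Properties using (just-injective)
open import Data.Nat.Base using (ℕ; zero; suc; _≤_; _<_; z≤n; s≤s; _⊔_; _≤‴_; ≤‴-refl; ≤‴-step)
  renaming (_+_ to _+ℕ_)
open import Data.Nat.Properties hiding (suc-injective)
open import Data.Product.Base using (∃; ∃₂; _×_; _,_; proj₁; proj₂)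
open import Data.Sum.Base using (_⊎_; inj₁; inj₂)
open import Function.Base using (_∘_; id; case_of_)
open import Function.Bundles using (_↔_; Inverse)
open import Level using (0ℓ)
open import Relation.Binary.Core using (Rel; _Preserves_⟶_)
open import Relation.Binary.Definitions using (tri<; tri≈; tri>)
open import Relation.Binary.PropositionalEquality hiding ([_])
open import Relation.Nullary using (¬_; yes; no; contradiction)
open import Relation.Nullary.Decidable using (⌊_⌋; toWitness; fromWitness)
open import Relation.Unary using (Pred; _∈_)
open import Defs

-- Increasing sequences and their initial segments.

Sorted : Pred (List ℕ) 0ℓ
Sorted = AllPairs _<_

Increasing : Pred (ℕ → ℕ) 0ℓ
Increasing σ = σ Preserves _<_ ⟶ _<_

private
  variable
    C S : Set
    s t u v w : List ℕ
    x y : ℕ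
    Γ : Pred (List ℕ) 0ℓ
    σ : ℕ → ℕ

sorted-applyUpTo : Increasing σ → ∀ n → Sorted (applyUpTo σ n)
sorted-applyUpTo inc n = AllPairs.applyUpTo⁺₁ _ n (λ i<j _ → inc i<j)

increasing-suc : (∀ i → σ i < σ (suc i)) → Increasing σ
increasing-suc {σ} step {i} {suc j} (s≤s i≤j) with m≤n⇒m<n∨m≡n i≤j
... | inj₁ i<j  = <-trans (increasing-suc step i<j) (step j)
... | inj₂ refl = step i

applyUpTo-< : ∀ (σ : ℕ → C) {m n} → m < n → ∃₂ λ y w → applyUpTo σ n ≡ applyUpTo σ m ++ y ∷ w
applyUpTo-< σ {zero}  {suc n} _         = _ , _ , refl
applyUpTo-< σ {suc m} {suc n} (s≤s m<n) with applyUpTo-< (σ ∘ suc) m<n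
... | y , w , eq = y , w , cong (σ 0 ∷_) eq

++-comparable : ∀ (u {v} u′ {v′} : List C) → u ++ v ≡ u′ ++ v′ →
                (∃ λ z → u′ ≡ u ++ z) ⊎ (∃ λ z → u ≡ u′ ++ z)
++-comparable []      u′       _  = inj₁ (u′ , refl)
++-comparable (x ∷ u) []       _  = inj₂ (x ∷ u , refl)
++-comparable (x ∷ u) (y ∷ u′) eq with ∷-injective eq
... | refl , eq′ with ++-comparable u u′ eq′
...   | inj₁ (z , p) = inj₁ (z , cong (x ∷_) p)
...   | inj₂ (z , p) = inj₂ (z , cong (x ∷_) p)

sorted-++⁻ : ∀ u → Sorted (u ++ v) → Sorted u × All (λ x → All (x <_) v) u × Sorted v
sorted-++⁻ []      so       = [] , [] , so
sorted-++⁻ (x ∷ u) (p ∷ so) with sorted-++⁻ u so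
... | su , u<v , sv = All.++⁻ˡ u p ∷ su , All.++⁻ʳ u p ∷ u<v , sv

-- Fronts and their shifts.

-- What the proof uses of a barrier.  Write s ◁ t if s = x ∷ u and t = u ++ y ∷ w with x ∷ u ++ y ∷ w increasing,
-- a strengthening of s ≪* t; consecutive says that every σ starts with such a pair.
record Front (Γ : Pred (List ℕ) 0ℓ) : Set where
  field
    prefix-free : ∀ {s v} → Γ s → Γ (s ++ v) → v ≡ []
    consecutive : ∀ σ → Increasing σ →
                  ∃₂ λ j k → j < k × Γ (applyUpTo σ (suc j)) × Γ (applyUpTo (σ ∘ suc) k)

  ++-unique : ∀ {u′ v′} → Γ u → Γ u′ → u ++ v ≡ u′ ++ v′ → u ≡ u′
  ++-unique {u} {_} {u′} g g′ eq with ++-comparable u u′ eq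
  ... | inj₁ (z , refl) = trans (sym (++-identityʳ u)) (cong (u ++_) (sym (prefix-free g g′)))
  ... | inj₂ (z , refl) = trans (cong (u′ ++_) (prefix-free g′ g)) (++-identityʳ u′)

  applyUpTo-unique : ∀ {m n} → Γ (applyUpTo σ m) → Γ (applyUpTo σ n) → m ≡ n
  applyUpTo-unique {σ} {m} {n} g g′ with <-cmp m n
  ... | tri≈ _ m≡n _ = m≡n
  ... | tri< m<n _ _ with applyUpTo-< σ m<n
  ...   | y , w , eq = case prefix-free g (subst Γ eq g′) of λ ()
  applyUpTo-unique {σ} {m} {n} g g′ | tri> _ _ n<m with applyUpTo-< σ n<m
  ...   | y , w , eq = case prefix-free g′ (subst Γ eq g) of λ ()

applyUpTo-∈ : ∀ (σ : ℕ → ℕ) {m n} → m ≤ n → ∀ {x} → x ∈ₗ applyUpTo σ m → x ∈ₗ applyUpTo σ n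
applyUpTo-∈ σ m≤n x∈ with Any.applyUpTo⁻ σ x∈
... | i , i<m , refl = Any.applyUpTo⁺ σ refl (<-≤-trans i<m m≤n)

-- Both fields rest on the antichain condition. A proper increasing extension has strictly more
-- values. If t along `σ ∘ suc` does not reach past s along `σ`, the values of t lie in those of s
-- and miss `σ 0`.
barrier⇒front : Barrier Γ → Front Γ
barrier⇒front {Γ} b = record { prefix-free = pf ; consecutive = cons }
  where
  open Barrier b
  pf : ∀ {s v} → Γ s → Γ (s ++ v) → v ≡ []
  pf {s} {[]}    g g′ = refl
  pf {s} {z ∷ v} g g′ = ⊥-elim (antichain g g′ (Any.++⁺ˡ , λ sub →
    <-irrefl refl (All.lookup (All.map All.head (proj₁ (proj₂ (sorted-++⁻ s (Linked⇒AllPairs <-trans (increasing g′))))))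
                              (sub (Any.++⁺ʳ s (here refl))))))

  -- The antichain condition would leave `[]` as the only member, so `Γ` would be finite.
  []∉Γ : ¬ Γ []
  []∉Γ g = infinite ([ [] ] , λ where
    []      _  → here refl
    (x ∷ s) g′ → ⊥-elim (antichain g g′ ((λ ()) , λ sub → case sub (here refl) of λ ())))

  cons : ∀ σ → Increasing σ → ∃₂ λ j k → j < k × Γ (applyUpTo σ (suc j)) × Γ (applyUpTo (σ ∘ suc) k)
  cons σ inc with meets σ inc | meets (σ ∘ suc) (λ i<j → inc (s≤s i<j))
  ... | []    , g , _  | _               = contradiction g []∉Γ
  ... | s@(_ ∷ s′) , g , eq | t , g′ , eq′ = length s′ , length t , ≰⇒> j≮k , gs , gt
    where
    gs = subst Γ eq g
    gt = subst Γ eq′ g′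
    j≮k : ¬ (length t ≤ length s′)
    j≮k k≤j = antichain gt gs (there ∘ applyUpTo-∈ (σ ∘ suc) k≤j ,
      λ sub → case Any.applyUpTo⁻ (σ ∘ suc) (sub (here refl)) of λ
        (i , _ , e) → <-irrefl e (inc (s≤s z≤n)))

-- { s ∪ t ∣ s ◁ t }
Shift : Pred (List ℕ) 0ℓ → Pred (List ℕ) 0ℓ
Shift Γ l = ∃₂ λ x u → ∃₂ λ y w → l ≡ x ∷ u ++ y ∷ w × Sorted l × Γ (x ∷ u) × Γ (u ++ y ∷ w)

shift-applyUpTo : ∀ {j k} → Increasing σ → j < k → Γ (applyUpTo σ (suc j)) → Γ (applyUpTo (σ ∘ suc) k) →
                  Shift Γ (applyUpTo σ (suc k))
shift-applyUpTo {σ} {Γ} {j} {k} inc j<k gs gt with applyUpTo-< (σ ∘ suc) j<k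
... | y , w , eq = σ 0 , _ , y , w , cong (σ 0 ∷_) eq , sorted-applyUpTo inc (suc k) , gs , subst Γ eq gt

shift-tail : Shift Γ (x ∷ t) → Γ t
shift-tail (_ , _ , _ , _ , refl , _ , _ , gt) = gt

-- Deleting the least element of s ∪ t leaves t, which reduces prefix-freeness to that of `Γ`. Along
-- `σ` there are s ◁ t ◁ r, and s ∪ t, t ∪ r are then consecutive; `applyUpTo-unique` shows that
-- both calls of `consecutive` produce the same t.
shift-front : Front Γ → Front (Shift Γ)
shift-front {Γ} fr = record
  { prefix-free = λ where (_ , _ , _ , _ , refl , _ , _ , gt) g′ → prefix-free gt (shift-tail {Γ = Γ} g′)
  ; consecutive = consecutive′
  }
  where
  open Front fr
  consecutive′ : ∀ σ → Increasing σ →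
                 ∃₂ λ j k → j < k × Shift Γ (applyUpTo σ (suc j)) × Shift Γ (applyUpTo (σ ∘ suc) k)
  consecutive′ σ inc with consecutive σ inc | consecutive (σ ∘ suc) (λ i<j → inc (s≤s i<j))
  ... | j , k , j<k , gs , gt | j′ , k′ , j′<k′ , gs′ , gt′
    with applyUpTo-unique {m = k} {n = suc j′} gt gs′
  ... | refl = suc j′ , suc k′ , s≤s j′<k′ , shift-applyUpTo {Γ = Γ} inc j<k gs gt ,
               shift-applyUpTo {Γ = Γ} (λ i<j → inc (s≤s i<j)) j′<k′ gs′ gt′

-- Subwords and denotations.

++-≼ʷ : ∀ w₁ {w₂ w : List S} → w₁ ++ w₂ ≼ʷ w →
        ∃₂ λ w₁′ w₂′ → w ≡ w₁′ ++ w₂′ × w₁ ≼ʷ w₁′ × w₂ ≼ʷ w₂′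
++-≼ʷ []       p           = [] , _ , refl , [] , p
++-≼ʷ (a ∷ w₁) (y ∷ʳ p)    with ++-≼ʷ (a ∷ w₁) p
... | w₁′ , w₂′ , refl , p₁ , p₂ = y ∷ w₁′ , w₂′ , refl , y ∷ʳ p₁ , p₂
++-≼ʷ (a ∷ w₁) (refl ∷ p)  with ++-≼ʷ w₁ p
... | w₁′ , w₂′ , refl , p₁ , p₂ = a ∷ w₁′ , w₂′ , refl , refl ∷ p₁ , p₂

upward-closed : ∀ (φ : 𝕃₂ S) {w w′} → w ≼ʷ w′ → w ∈ ⟦ φ ⟧ → w′ ∈ ⟦ φ ⟧
upward-closed (atom a)  p q        = ⊆-trans q p
upward-closed (φ₁ • φ₂) p (w₁ , w₂ , refl , q₁ , q₂) with ++-≼ʷ w₁ p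
... | w₁′ , w₂′ , eq , p₁ , p₂ = w₁′ , w₂′ , eq , upward-closed φ₁ p₁ q₁ , upward-closed φ₂ p₂ q₂
upward-closed (φ₁ & φ₂) p (q₁ , q₂) = upward-closed φ₁ p q₁ , upward-closed φ₂ p q₂
upward-closed (φ₁ + φ₂) p (inj₁ q)  = inj₁ (upward-closed φ₁ p q)
upward-closed (φ₁ + φ₂) p (inj₂ q)  = inj₂ (upward-closed φ₂ p q)

-- Bad arrays and auxiliary facts on sets and words.

-- `A` is the set to which the array is restricted; `f` is total, with arbitrary values off `Γ`.
-- Boolean sets keep quantification over them in `Set`, where excluded middle at level `0ℓ` applies.
Bad : {Q : Set} → Pred (List ℕ) 0ℓ → Rel Q 0ℓ → (ℕ → Bool) → (List ℕ → Q) → Set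
Bad Γ _⊑_ A f = ∀ {x u y w} → Sorted (x ∷ u ++ y ∷ w) → All (T ∘ A) (x ∷ u ++ y ∷ w) →
                Γ (x ∷ u) → Γ (u ++ y ∷ w) → ¬ (f (x ∷ u) ⊑ f (u ++ y ∷ w))

Unbounded : (ℕ → Bool) → Set
Unbounded A = ∀ m → ∃ λ x → m < x × T (A x)

Pigeonhole : Set → Set
Pigeonhole C = ∀ (c : ℕ → C) → ∃ λ k → ∀ m → ∃ λ i → m ≤ i × c i ≡ k

_⊆ᵇ_ : (ℕ → Bool) → (ℕ → Bool) → Set
A ⊆ᵇ B = ∀ {x} → T (A x) → T (B x)

increasing-≤ : Increasing σ → ∀ i → i ≤ σ i
increasing-≤ inc zero    = z≤n
increasing-≤ inc (suc i) = ≤-<-trans (increasing-≤ inc i) (inc (n<1+n i))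

increasing-cancel-< : Increasing σ → ∀ {i j} → σ i < σ j → i < j
increasing-cancel-< {σ} inc {i} {j} σi<σj = ≰⇒> λ j≤i → case m≤n⇒m<n∨m≡n j≤i of λ where
  (inj₁ j<i)  → <-asym σi<σj (inc j<i)
  (inj₂ refl) → <-irrefl refl σi<σj

increasing-mono-≤ : ∀ {σ} → Increasing σ → ∀ {i j} → i ≤ j → σ i ≤ σ j
increasing-mono-≤ inc i≤j with m≤n⇒m<n∨m≡n i≤j
... | inj₁ i<j  = <⇒≤ (inc i<j)
... | inj₂ refl = ≤-refl

-- The subsets of the interval of length `k` starting at `m`, as increasing lists.
sortedFrom : ℕ → ℕ → List (List ℕ)
sortedFrom m zero    = [ [] ]
sortedFrom m (suc k) = sortedFrom (suc m) k ++ map (m ∷_) (sortedFrom (suc m) k)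

∈-sortedFrom : ∀ m k → Sorted s → All (m ≤_) s → All (_< m +ℕ k) s → s ∈ₗ sortedFrom m k
∈-sortedFrom {[]}    m zero    _  _ _ = here refl
∈-sortedFrom {[]}    m (suc k) _  _ _ = ∈-++⁺ˡ (∈-sortedFrom (suc m) k [] [] [])
∈-sortedFrom {x ∷ s} m zero    _  (m≤x ∷ _) (x<m ∷ _) =
  contradiction (subst (x <_) (+-identityʳ m) x<m) (≤⇒≯ m≤x)
∈-sortedFrom {x ∷ s} m (suc k) (x<s ∷ so) (m≤x ∷ _) (x<b ∷ s<b) with m≤n⇒m<n∨m≡n m≤x
... | inj₁ m<x  = ∈-++⁺ˡ (∈-sortedFrom (suc m) k (x<s ∷ so) (m<x ∷ All.map (<-trans m<x) x<s)
                    (subst (λ b → All (_< b) (x ∷ s)) (+-suc m k) (x<b ∷ s<b)))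
... | inj₂ refl = ∈-++⁺ʳ (sortedFrom (suc m) k) (∈-map⁺ (m ∷_) (∈-sortedFrom (suc m) k so x<s
                    (subst (λ b → All (_< b) s) (+-suc m k) s<b)))

≼ʷ-length⇒≡ : ∀ {w w′ : List S} → w ≼ʷ w′ → length w′ ≤ length w → w ≡ w′
≼ʷ-length⇒≡ p len = ≋⇒≡ (to-≋ (≤-antisym (length-mono-≤ p) len) p)

-- This keeps an array bad when first letters are deleted. Comparing heads in `Maybe` covers two
-- empty words as well.
≼ʷ-head : ∀ (w w′ : List S) → head w ≡ head w′ → drop 1 w ≼ʷ drop 1 w′ → w ≼ʷ w′
≼ʷ-head []      []       _  _ = []
≼ʷ-head (a ∷ w) (b ∷ w′) eq p = just-injective eq ∷ p

unbounded-enumeration : ∀ {A} → Unbounded A → ∃ λ σ → Increasing σ × ∀ i → T (A (σ i))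
unbounded-enumeration {A} unb = proj₁ ∘ elem , increasing-suc (λ i → proj₁ (proj₂ (unb (proj₁ (elem i))))) , proj₂ ∘ elem
  where
  elem : ℕ → ∃ λ x → T (A x)
  elem zero    = let (x , _ , x∈) = unb 0 in x , x∈
  elem (suc i) = let (x , _ , x∈) = unb (proj₁ (elem i)) in x , x∈

-- Words separating constraints.

module _ (em : ExcludedMiddle 0ℓ) where

  -- For s ◁ t ◁ r the word at s ∪ t lies in ⟦f t⟧ and the word at t ∪ r does not, so by upward
  -- closure the first is no subword of the second.
  shift-bad : Front Γ → ∀ {A} {f : List ℕ → 𝕃₂ S} → Bad Γ _≼_ A f → ∃ λ g → Bad (Shift Γ) (_≼ʷ_ {A = S}) A g
  shift-bad {Γ} {S} fr {A} {f} bad = g , bad′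
    where
    Separates : List ℕ → List S → Set
    Separates l w = ∃₂ λ x u → ∃₂ λ y v → l ≡ x ∷ u ++ y ∷ v × Γ (x ∷ u) × Γ (u ++ y ∷ v) ×
                    w ∈ ⟦ f (u ++ y ∷ v) ⟧ × ¬ (w ∈ ⟦ f (x ∷ u) ⟧)

    g : List ℕ → List S
    g l with em {∃ (Separates l)}
    ... | yes (w , _) = w
    ... | no  _       = []

    separation : ∀ {φ ψ : 𝕃₂ S} → ¬ (φ ≼ ψ) → ∃ λ w → w ∈ ⟦ ψ ⟧ × ¬ (w ∈ ⟦ φ ⟧)
    separation {φ} {ψ} φ⋠ψ with em {∃ λ w → w ∈ ⟦ ψ ⟧ × ¬ (w ∈ ⟦ φ ⟧)}
    ... | yes p = p
    ... | no ¬p = ⊥-elim (φ⋠ψ sub)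
      where
      sub : φ ≼ ψ
      sub {w} w∈ψ with em {w ∈ ⟦ φ ⟧}
      ... | yes w∈φ = w∈φ
      ... | no  w∉φ = contradiction (w , w∈ψ , w∉φ) ¬p

    g-separates : ∀ {l} → Shift Γ l → All (T ∘ A) l → Separates l (g l)
    g-separates {l} (x , u , y , v , refl , so , gs , gt) al with em {∃ (Separates l)}
    ... | yes (_ , p) = p
    ... | no ¬p with separation {f (x ∷ u)} {f (u ++ y ∷ v)} (bad so al gs gt)
    ...   | w , w∈ , w∉ = contradiction (w , x , u , y , v , refl , gs , gt , w∈ , w∉) ¬p

    bad′ : Bad (Shift Γ) _≼ʷ_ A g
    bad′ {x} {u} {y} {w} so (ax ∷ al) gs gt g≼g
      with g-separates gs (ax ∷ All.++⁻ˡ u al) | g-separates gt al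
    -- The two decompositions are chosen independently; `++-unique` identifies `x′ ∷ u′` with `u`,
    -- the common t.
    ... | _ , _ , _ , _ , refl , _ , gu , in-u , _ | x′ , u′ , y′ , v′ , eq , gu′ , _ , _ , out
      = out (subst (λ t → g (u ++ y ∷ w) ∈ ⟦ f t ⟧)
              (Front.++-unique fr {u = u} {u′ = x′ ∷ u′} gu gu′ eq)
              (upward-closed (f u) g≼g in-u))

  -- The pigeonhole principle.

  ¬∀⇒∃¬ : {P : C → Set} → ¬ (∀ x → P x) → ∃ λ x → ¬ P x
  ¬∀⇒∃¬ {P = P} ¬∀ with em {∃ λ x → ¬ P x}
  ... | yes p = p
  ... | no ¬p = contradiction (λ x → case em {P x} of λ where
    (yes px) → px
    (no ¬px) → contradiction (x , ¬px) ¬p) ¬∀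

  bounded-above : ∀ {n} (m : Fin n → ℕ) → ∃ λ b → ∀ k → m k ≤ b
  bounded-above {zero}  m = 0 , λ ()
  bounded-above {suc n} m with bounded-above (m ∘ suc)
  ... | b , m≤b = m zero ⊔ b , λ where
    zero    → m≤m⊔n _ _
    (suc k) → m≤n⇒m≤o⊔n _ (m≤b k)

  pigeonhole-Fin : ∀ n → Pigeonhole (Fin n)
  pigeonhole-Fin n c with em {∃ λ k → ∀ m → ∃ λ i → m ≤ i × c i ≡ k}
  ... | yes p = p
  -- From index `b` on no colour would occur any more, yet `c b` does.
  ... | no ¬p = ⊥-elim (proj₂ (late (c b)) (b , bound≤ (c b) , refl))
    where
    late : ∀ k → ∃ λ m → ¬ ∃ λ i → m ≤ i × c i ≡ k
    late k = ¬∀⇒∃¬ (λ often → ¬p (k , often))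
    b = proj₁ (bounded-above (proj₁ ∘ late))
    bound≤ = proj₂ (bounded-above (proj₁ ∘ late))

  pigeonhole-injection : (h : C → S) → (∀ {x y} → h x ≡ h y → x ≡ y) → Pigeonhole S → Pigeonhole C
  pigeonhole-injection h inj pigeon c with pigeon (h ∘ c)
  ... | k , often with often 0
  -- A single occurrence, here from `often 0`, shows that `k` is in the image of `h`.
  ...   | i₀ , _ , refl = c i₀ , λ m → case often m of λ (i , m≤i , eq) → i , m≤i , inj eq

  -- The partition theorem for fronts.

  module Ramsey (fr : Front Γ) (pigeon : Pigeonhole C) (c : List ℕ → C) where
    open Front fr

    Homogeneous : List ℕ → C → (ℕ → Bool) → Set
    Homogeneous u k B = ∀ {v} → Sorted (u ++ v) → All (T ∘ B) v → Γ (u ++ v) → c (u ++ v) ≡ k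

    -- Every `A` is allowed, so that a set already thinned for one stem can be thinned again for
    -- another.
    Homogenisable : List ℕ → Set
    Homogenisable u = ∀ A → Unbounded A → ∃ λ B → B ⊆ᵇ A × Unbounded B × ∃ λ k → Homogeneous u k B

    homogenisable-∈ : Γ u → Homogenisable u
    homogenisable-∈ {u} g A unb = A , id , unb , c u , λ _ _ g′ →
      cong c (trans (cong (u ++_) (prefix-free g g′)) (++-identityʳ u))

    -- Fusion: each stage thins its set for `u` extended by its point, and the next point comes from
    -- the thinned set. All later points thus lie in `rest` of a stage, so a colour depends only on
    -- the first point after `u`; the pigeonhole principle makes it constant.
    module Diagonal {u} (g : ¬ Γ u) {m} (extend : ∀ x → m < x → Homogenisable (u ++ [ x ]))
                    {A} (unb : Unbounded A) where

      record Stage : Set where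
        field
          set      : ℕ → Bool
          unbd     : Unbounded set
          point    : ℕ
          above    : m < point
          point∈   : T (set point)

        private thin = extend point above set unbd
        rest    = proj₁ thin
        rest⊆   = λ {x} → proj₁ (proj₂ thin) {x}
        restUnb = proj₁ (proj₂ (proj₂ thin))
        colour  = proj₁ (proj₂ (proj₂ (proj₂ thin)))
        homog   = λ {v} → proj₂ (proj₂ (proj₂ (proj₂ thin))) {v}

      open Stage

      next : Stage → Stage
      next st = let (x , p<x , x∈) = restUnb st (point st) in record
        { set = rest st ; unbd = restUnb st ; point = x ; above = <-trans (above st) p<x ; point∈ = x∈ }

      stage : ℕ → Stage
      stage zero    = record { set = A ; unbd = unb ; point = proj₁ (unb m)
                             ; above = proj₁ (proj₂ (unb m)) ; point∈ = proj₂ (proj₂ (unb m)) }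
      stage (suc i) = next (stage i)

      a : ℕ → ℕ
      a = point ∘ stage

      a-increasing : Increasing a
      a-increasing = increasing-suc λ i → proj₁ (proj₂ (restUnb (stage i) (a i)))

      stage-antitone : ∀ {i j} → i ≤ j → set (stage j) ⊆ᵇ set (stage i)
      stage-antitone {i} {zero}  z≤n = id
      stage-antitone {i} {suc j} i≤j with m≤n⇒m<n∨m≡n i≤j
      ... | inj₁ (s≤s i≤j′) = stage-antitone i≤j′ ∘ rest⊆ (stage j)
      ... | inj₂ refl       = id

      k = proj₁ (pigeon (colour ∘ stage))
      often = proj₂ (pigeon (colour ∘ stage))

      InB : ℕ → Set
      InB x = ∃ λ i → a i ≡ x × colour (stage i) ≡ k

      B : ℕ → Bool
      B x = ⌊ em {InB x} ⌋

      InB⁻ : T (B x) → InB x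
      InB⁻ {x} = toWitness {a? = em {InB x}}

      B-unb : Unbounded B
      B-unb b with often (suc b)
      ... | i , b<i , eq = a i , <-≤-trans b<i (increasing-≤ a-increasing i) ,
                           fromWitness {a? = em {InB (a i)}} (i , refl , eq)

      B⊆A : B ⊆ᵇ A
      B⊆A x∈B with InB⁻ x∈B
      ... | i , refl , _ = stage-antitone {0} {i} z≤n (point∈ (stage i))

      B-homogeneous : Homogeneous u k B
      B-homogeneous {[]}    _  _          g′ = contradiction (subst Γ (++-identityʳ u) g′) g
      B-homogeneous {x ∷ v} so (x∈ ∷ v∈) g′ with InB⁻ x∈
      ... | i , refl , eq = trans (cong c (sym assoc)) (trans (homog (stage i)
              (subst Sorted (sym assoc) so) (All.zipWith later (x<v , v∈)) (subst Γ (sym assoc) g′)) eq)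
        where
        assoc = ++-assoc u [ a i ] v
        x<v : All (a i <_) v
        x<v with proj₂ (proj₂ (sorted-++⁻ u so))
        ... | p ∷ _ = p
        later : ∀ {z} → a i < z × T (B z) → T (rest (stage i) z)
        later (ai<z , z∈B) with InB⁻ z∈B
        ... | j , refl , _ = stage-antitone {suc i} {j} (increasing-cancel-< a-increasing ai<z) (point∈ (stage j))

    -- The bound `m` allows a failing stem to be extended by a point above its last one.
    homogenisable-extend : ∀ {m} → (∀ x → m < x → Homogenisable (u ++ [ x ])) → Homogenisable u
    homogenisable-extend {u} extend A unb with em {Γ u}
    ... | yes g = homogenisable-∈ g A unb
    ... | no ¬g = B , B⊆A , B-unb , k , B-homogeneous
      where open Diagonal ¬g extend unb

    -- Bar induction: otherwise some increasing path avoids Γ.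
    module Path (¬hom : ¬ Homogenisable []) where
      -- The number is the last point of the stem, 0 at the root; taking the next point above it
      -- makes `path` increasing.
      Node : Set
      Node = ∃ λ u → ℕ × ¬ Homogenisable u

      child : ((u , m , _) : Node) → ∃ λ x → m < x × ¬ Homogenisable (u ++ [ x ])
      child (u , m , ¬h) with ¬∀⇒∃¬ (λ all → ¬h (homogenisable-extend {m = m} all))
      ... | x , ¬p with em {m < x}
      ...   | yes m<x = x , m<x , λ h → ¬p λ _ → h
      ...   | no  m≮x = contradiction (λ m<x → contradiction m<x m≮x) ¬p

      node : ℕ → Node
      node zero    = [] , 0 , ¬hom
      node (suc i) = let (x , _ , ¬h) = child (node i) in proj₁ (node i) ++ [ x ] , x , ¬h

      path : ℕ → ℕ
      path i = proj₁ (child (node i))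

      node-path : ∀ i → proj₁ (node i) ≡ applyUpTo path i
      node-path zero    = refl
      node-path (suc i) = trans (cong (_++ [ path i ]) (node-path i)) (applyUpTo-∷ʳ path i)

      absurd : Homogenisable []
      absurd with consecutive path (increasing-suc λ i → proj₁ (proj₂ (child (node (suc i)))))
      ... | j , _ , _ , gs , _ = contradiction (homogenisable-∈ (subst Γ (sym (node-path (suc j))) gs))
                                               (proj₂ (proj₂ (node (suc j))))

    ramsey : Homogenisable []
    ramsey with em {Homogenisable []}
    ... | yes hom = hom
    ... | no ¬hom = Path.absurd ¬hom

  -- Minimal bad arrays.

  module Arrays (S : Set) (Γ : Pred (List ℕ) 0ℓ) where

    record BadArray : Set where
      field
        dom : ℕ → Bool
        val : List ℕ → List S
        unb : Unbounded dom
        bad : Bad Γ _≼ʷ_ dom val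

    open BadArray

    -- At stage n neither dom up to n nor val on sequences below n changes, so dom and val converge along the stages.
    record Refines (n : ℕ) (q p : BadArray) : Set where
      field
        dom⊆   : dom q ⊆ᵇ dom p
        keeps  : ∀ {x} → x ≤ n → T (dom p x) → T (dom q x)
        below  : ∀ s → val q s ≼ʷ val p s
        frozen : ∀ {s} → All (_< n) s → val q s ≡ val p s

    open Refines

    refines-refl : ∀ {n p} → Refines n p p
    refines-refl = record { dom⊆ = id ; keeps = λ _ → id ; below = λ _ → ⊆-refl ; frozen = λ _ → refl }

    refines-trans : ∀ {n p q r} → Refines n r q → Refines n q p → Refines n r p
    refines-trans a b = record
      { dom⊆   = dom⊆ b ∘ dom⊆ a
      ; keeps  = λ x≤n → keeps a x≤n ∘ keeps b x≤n
      ; below  = λ s → ⊆-trans (below a s) (below b s)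
      ; frozen = λ s<n → trans (frozen a s<n) (frozen b s<n)
      }

    refines-≤ : ∀ {m n p q} → m ≤ n → Refines n q p → Refines m q p
    refines-≤ m≤n a = record
      { dom⊆   = dom⊆ a
      ; keeps  = λ x≤m → keeps a (≤-trans x≤m m≤n)
      ; below  = below a
      ; frozen = λ s<m → frozen a (All.map (λ x<m → <-≤-trans x<m m≤n) s<m)
      }

    MinimalAt : ℕ → List ℕ → BadArray → Set
    MinimalAt n s p = ∀ {q} → Refines n q p → val q s ≡ val p s

    minimalAt-refines : ∀ {n s p q} → Refines n q p → MinimalAt n s p → MinimalAt n s q
    minimalAt-refines a min b = trans (min (refines-trans b a)) (sym (min a))

    -- A refinement that changes the word at `s` shortens it, since a subword of full length is the
    -- whole word. So `k` bounds the number of replacements.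
    minimise-at : ∀ n s k p → length (val p s) ≤ k → ∃ λ q → Refines n q p × MinimalAt n s q
    minimise-at n s k p len with em {∃ λ q → Refines n q p × length (val q s) < length (val p s)}
    ... | no ¬shorter = p , refines-refl , λ {q} a → ≼ʷ-length⇒≡ (below a s) (≮⇒≥ λ lt → ¬shorter (q , a , lt))
    minimise-at n s zero    p len | yes (q , a , lt) = case <-≤-trans lt len of λ ()
    minimise-at n s (suc k) p len | yes (q , a , lt) with minimise-at n s k q (≤-pred (<-≤-trans lt len))
    ... | r , b , min = r , refines-trans b a , λ {q} → min {q}

    minimise-all : ∀ n ss p → ∃ λ q → Refines n q p × All (λ s → MinimalAt n s q) ss
    minimise-all n []       p = p , refines-refl , []
    minimise-all n (s ∷ ss) p with minimise-at n s _ p ≤-refl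
    ... | q , a , min with minimise-all n ss q
    ...   | r , b , mins = r , refines-trans b a , (λ {q} → minimalAt-refines b (λ {q} → min {q}) {q}) ∷ mins

    -- For lists below `n` this is `frozen`; the content is in lists with greatest element `n`.
    Minimal : ℕ → BadArray → Set
    Minimal n p = ∀ {s} → Sorted s → All (_≤ n) s → MinimalAt n s p

    minimise : ∀ n p → ∃ λ q → Refines n q p × Minimal n q
    minimise n p with minimise-all n (sortedFrom 0 (suc n)) p
    ... | q , a , mins = q , a , λ {s} so s≤n {r} → All.lookup mins
            (∈-sortedFrom 0 (suc n) so (All.universal (λ _ → z≤n) s) (All.map s≤s s≤n)) {r}

    -- The limit of the stages.

    module Limit (p₀ : BadArray) where

      next : ℕ → BadArray → BadArray
      next n p with em {T (dom p n)}
      ... | yes _ = proj₁ (minimise n p)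
      ... | no  _ = p

      next-refines : ∀ n p → Refines n (next n p) p
      next-refines n p with em {T (dom p n)}
      ... | yes _ = proj₁ (proj₂ (minimise n p))
      ... | no  _ = refines-refl

      next-minimal : ∀ n p → T (dom p n) → Minimal n (next n p)
      next-minimal n p n∈ {s} with em {T (dom p n)}
      ... | yes _  = λ so s≤n {q} → proj₂ (proj₂ (minimise n p)) so s≤n {q}
      ... | no  n∉ = contradiction n∈ n∉

      next-skip : ∀ n p → ¬ T (dom p n) → next n p ≡ p
      next-skip n p n∉ with em {T (dom p n)}
      ... | yes n∈ = contradiction n∈ n∉
      ... | no  _  = refl

      stage : ℕ → BadArray
      stage zero    = p₀
      stage (suc n) = next n (stage n)

      stage-refines : ∀ {m n} → m ≤ n → Refines m (stage n) (stage m)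
      stage-refines {n = zero}  z≤n = refines-refl
      stage-refines {n = suc n} m≤n with m≤n⇒m<n∨m≡n m≤n
      ... | inj₁ (s≤s m≤n′) = refines-trans (refines-≤ m≤n′ (next-refines n (stage n))) (stage-refines m≤n′)
      ... | inj₂ refl       = refines-refl

      -- From this stage on the value at `s` is frozen, so `val∞` reads it here.
      height : List ℕ → ℕ
      height s = suc (max 0 s)

      s<height : ∀ s → All (_< height s) s
      s<height s = All.map s≤s (xs≤max 0 s)

      -- Later stages keep the elements up to `x`, so membership of `x` is settled at stage `x`.
      dom∞ : ℕ → Bool
      dom∞ x = dom (stage x) x

      val∞ : List ℕ → List S
      val∞ s = val (stage (height s)) s

      val∞-stage : ∀ {n s} → All (_< n) s → val∞ s ≡ val (stage n) s
      val∞-stage {n} {s} s<n with ≤-total n (height s)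
      ... | inj₁ n≤h = frozen (stage-refines n≤h) s<n
      ... | inj₂ h≤n = sym (frozen (stage-refines h≤n) (s<height s))

      dom∞⊆stage : ∀ n → dom∞ ⊆ᵇ dom (stage n)
      dom∞⊆stage n {x} x∈ with ≤-total n x
      ... | inj₁ n≤x = dom⊆ (stage-refines n≤x) x∈
      ... | inj₂ x≤n = keeps (stage-refines x≤n) ≤-refl x∈

      val∞≼stage : ∀ n s → val∞ s ≼ʷ val (stage n) s
      val∞≼stage n s with ≤-total n (height s)
      ... | inj₁ n≤h = below (stage-refines n≤h) s
      ... | inj₂ h≤n = ⊆-reflexive (sym (frozen (stage-refines h≤n) (s<height s)))

      -- The stages skip every n outside the current domain, so the next element of that domain survives.
      reach : ∀ {n x} → n ≤‴ x → T (dom (stage n) x) → ∃ λ y → n ≤ y × T (dom∞ y)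
      reach {n} n≤x x∈ with em {T (dom (stage n) n)}
      ... | yes n∈ = n , ≤-refl , n∈
      reach ≤‴-refl       x∈ | no n∉ = contradiction x∈ n∉
      reach {n} {x} (≤‴-step lt) x∈ | no n∉
        with reach lt (subst (λ p → T (dom p x)) (sym (next-skip n (stage n) n∉)) x∈)
      ... | y , n<y , y∈ = y , <⇒≤ n<y , y∈

      limit : BadArray
      limit = record { dom = dom∞ ; val = val∞ ; unb = unb∞ ; bad = bad∞ }
        where
        unb∞ : Unbounded dom∞
        unb∞ m with unb (stage (suc m)) m
        ... | x , m<x , x∈ = reach (≤⇒≤‴ m<x) x∈

        bad∞ : Bad Γ _≼ʷ_ dom∞ val∞
        -- Past all elements of s ∪ t, a stage has the final values at both s and t, so its badness
        -- decides.
        bad∞ {x} {u} {y} {w′} so ∈A gs gt F≼F = bad (stage h) so (All.map (dom∞⊆stage h) ∈A) gs gt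
          (subst₂ _≼ʷ_ (val∞-stage (All.++⁻ˡ (x ∷ u) (s<height l))) (val∞-stage (All.tail (s<height l))) F≼F)
          where
          l = x ∷ u ++ y ∷ w′
          h = height l

      limit-refines : ∀ n → Refines n limit (stage (suc n))
      limit-refines n = record
        { dom⊆   = dom∞⊆stage (suc n)
        ; keeps  = λ {x} x≤n x∈ → dom⊆ (stage-refines (m≤n⇒m≤1+n x≤n)) x∈
        ; below  = val∞≼stage (suc n)
        ; frozen = λ s<n → val∞-stage (All.map m<n⇒m<1+n s<n)
        }

      -- Since `n` was not skipped, `stage (suc n)` is minimal at `n`; the limit refines that stage,
      -- and refinements inherit minimality.
      limit-minimal : ∀ {n} → T (dom∞ n) → Minimal n limit
      limit-minimal {n} n∈ so s≤n {q} = minimalAt-refines (limit-refines n)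
        (λ {q} → next-minimal n (stage n) n∈ so s≤n {q}) {q}

    -- Deleting a constant first letter.

    module Descent (fr : Front Γ) (pigeon : Pigeonhole (Maybe S)) (p₀ : BadArray) where
      open Front fr
      open Limit p₀ using (limit; limit-minimal)

      A = dom limit
      F = val limit

      homogeneous = Ramsey.ramsey fr pigeon (head ∘ F) A (unb limit)

      B : ℕ → Bool
      B = proj₁ homogeneous

      B⊆A : B ⊆ᵇ A
      B⊆A = proj₁ (proj₂ homogeneous)

      B-unb : Unbounded B
      B-unb = proj₁ (proj₂ (proj₂ homogeneous))

      heads-agree : Sorted s → Sorted t → All (T ∘ B) s → All (T ∘ B) t → Γ s → Γ t → head (F s) ≡ head (F t)
      heads-agree so so′ s∈ t∈ gs gt = trans (hom so s∈ gs) (sym (hom so′ t∈ gt))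
        where hom = λ {v} → proj₂ (proj₂ (proj₂ (proj₂ homogeneous))) {v}

      module _ (n : ℕ) where

        -- Deletion is confined to lists inside `B`, where heads agree, and avoids lists below `n`,
        -- which a refinement must not change.
        Late : List ℕ → Set
        Late s = All (T ∘ B) s × Any (n ≤_) s

        val′ : List ℕ → List S
        val′ s with em {Late s}
        ... | yes _ = drop 1 (F s)
        ... | no  _ = F s

        val′-late : Late s → val′ s ≡ drop 1 (F s)
        val′-late {s} late with em {Late s}
        ... | yes _    = refl
        ... | no ¬late = contradiction late ¬late

        val′-early : ¬ Late s → val′ s ≡ F s
        val′-early {s} ¬late with em {Late s}
        ... | yes late = contradiction late ¬late
        ... | no  _    = refl

        val′≼ : ∀ s → val′ s ≼ʷ F s
        val′≼ s with em {Late s}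
        ... | yes _ = drop-⊆ 1 (F s)
        ... | no  _ = ⊆-refl

        -- Up to `n` all of `A` stays, as `keeps` demands; above `n` only `B`, so that the successor
        -- of a late list is late.
        dom′ : ℕ → Bool
        dom′ x with x ≤? n
        ... | yes _ = A x
        ... | no  _ = B x

        dom′-≤ : x ≤ n → T (A x) → T (dom′ x)
        dom′-≤ {x} x≤n x∈ with x ≤? n
        ... | yes _  = x∈
        ... | no x≰n = contradiction x≤n x≰n

        dom′-> : n < x → dom′ x ≡ B x
        dom′-> {x} n<x with x ≤? n
        ... | yes x≤n = contradiction n<x (≤⇒≯ x≤n)
        ... | no  _   = refl

        dom′⊆A : dom′ ⊆ᵇ A
        dom′⊆A {x} x∈ with x ≤? n
        ... | yes _ = x∈
        ... | no  _ = B⊆A x∈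

        unb′ : Unbounded dom′
        unb′ m with B-unb (m ⊔ n)
        ... | x , m⊔n<x , x∈ = x , ≤-<-trans (m≤m⊔n m n) m⊔n<x ,
                subst T (sym (dom′-> (≤-<-trans (m≤n⊔m m n) m⊔n<x))) x∈

        -- If s ◁ t, the elements of t outside s exceed those of s, one of which is at least n.
        late-next : ∀ {x u y w} → Sorted (x ∷ u ++ y ∷ w) → All (T ∘ dom′) (x ∷ u ++ y ∷ w) →
                    Late (x ∷ u) → Late (u ++ y ∷ w)
        late-next {x} {u} {y} {w} so ∈A (x∈ ∷ u∈ , n≤) =
          All.++⁺ u∈ (All.zipWith (λ (n<z , z∈) → subst T (dom′-> n<z) z∈) (n<yw , All.++⁻ʳ (x ∷ u) ∈A)) ,
          Any.++⁺ʳ u (here (<⇒≤ (All.head n<yw)))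
          where
          n<yw : All (n <_) (y ∷ w)
          n<yw with All.lookupAny (proj₁ (proj₂ (sorted-++⁻ (x ∷ u) so))) n≤
          ... | z<yw , n≤z = All.map (≤-<-trans n≤z) z<yw

        -- If s is not late, its word is unchanged and that of t is a subword of the old one, so an
        -- embedding already contradicts `limit`. If s is late, so is t, and restoring the common
        -- first letter gives an embedding of the old words.
        bad′ : Bad Γ _≼ʷ_ dom′ val′
        bad′ {x} {u} {y} {w} so ∈A gs gt le with em {Late (x ∷ u)}
        ... | no _     = bad limit so (All.map (λ {x} → dom′⊆A {x}) ∈A) gs gt (⊆-trans le (val′≼ _))
        ... | yes late = bad limit so (All.map (λ {x} → dom′⊆A {x}) ∈A) gs gt
                (≼ʷ-head _ _ (heads-agree (proj₁ (sorted-++⁻ (x ∷ u) so)) (AllPairs.tail so) (proj₁ late) (proj₁ late′) gs gt)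
                  (subst (_ ≼ʷ_) (val′-late late′) le))
          where
          late′ = late-next so ∈A late

        dropped : BadArray
        dropped = record { dom = dom′ ; val = val′ ; unb = unb′ ; bad = bad′ }

        dropped-refines : Refines n dropped limit
        dropped-refines = record
          { dom⊆   = λ {x} → dom′⊆A {x}
          ; keeps  = dom′-≤
          ; below  = val′≼
          ; frozen = λ s<n → val′-early λ (_ , n≤) →
              let (x<n , n≤x) = All.lookupAny s<n n≤ in <⇒≱ x<n n≤x
          }

      -- `dropped x` refines `limit`, so by minimality deleting the first letter leaves the word
      -- unchanged.
      empty : T (A x) → Sorted s → All (_≤ x) s → Late x s → F s ≡ []
      empty {x} {s} x∈ so s≤x late with F s | trans (sym (val′-late x late)) (limit-minimal x∈ so s≤x (dropped-refines x))
      ... | []    | _ = refl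
      ... | _ ∷ _ | ()

      -- Along an enumeration `σ` of `B`, the initial segment in `Γ` has greatest element `σ j` and
      -- is late there, so its word is empty and embeds in every other.
      no-bad-array : ⊥
      no-bad-array with unbounded-enumeration B-unb
      ... | σ , inc , σ∈B with consecutive σ inc
      ...   | j , k , j<k , gs , gt with applyUpTo-< (σ ∘ suc) j<k
      ...     | y , w , eq = bad limit
                  (subst (Sorted ∘ (σ 0 ∷_)) eq (sorted-applyUpTo inc (suc k)))
                  (subst (All (T ∘ A) ∘ (σ 0 ∷_)) eq (All.applyUpTo⁺₂ σ (suc k) (B⊆A ∘ σ∈B)))
                  gs (subst Γ eq gt)
                  (subst (_≼ʷ F (applyUpTo (σ ∘ suc) j ++ y ∷ w)) (sym F[s]≡[]) (minimum _))
        where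
        F[s]≡[] : F (applyUpTo σ (suc j)) ≡ []
        F[s]≡[] = empty (B⊆A (σ∈B j)) (sorted-applyUpTo inc (suc j))
          (All.applyUpTo⁺₁ σ (suc j) λ i<1+j → increasing-mono-≤ inc (≤-pred i<1+j))
          (All.applyUpTo⁺₂ σ (suc j) σ∈B , Any.applyUpTo⁺ σ ≤-refl (n<1+n j))

-- Barriers and finite alphabets.

++⇒≪ : ∀ u → u ≪ u ++ y ∷ w
++⇒≪ []      = [] , λ ()
++⇒≪ (x ∷ u) = let (p , u≢) = ++⇒≪ u in refl ∷ p , u≢ ∘ proj₂ ∘ ∷-injective

pigeonhole-Maybe : ExcludedMiddle 0ℓ → ∀ {n} → S ↔ Fin n → Pigeonhole (Maybe S)
pigeonhole-Maybe {S} em {n} S↔Fin = pigeonhole-injection em colour colour-injective (pigeonhole-Fin em (suc n))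
  where
  open Inverse S↔Fin
  colour : Maybe S → Fin (suc n)
  colour nothing  = zero
  colour (just a) = suc (to a)
  colour-injective : ∀ {a b} → colour a ≡ colour b → a ≡ b
  colour-injective {nothing} {nothing} _  = refl
  colour-injective {just a}  {just b}  eq = cong just (trans (sym (strictlyInverseʳ a))
    (trans (cong from (Fin.suc-injective eq)) (strictlyInverseʳ b)))

theorem9p2 : ExcludedMiddle 0ℓ → ∀ (Σ : Set) (n : ℕ) → Σ ↔ Fin n → IsBetterQuasiOrder (_≼_ {Σ})
theorem9p2 em Σ n Σ↔Fin = record
  { isPreorder = record
    { isEquivalence = isEquivalence
    ; reflexive     = λ where refl → id
    ; trans         = λ φ≼ψ ψ≼χ → φ≼ψ ∘ ψ≼χ
    }
  ; good = good
  }
  where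
  good : ∀ β → Barrier β → (f : ∃ β → 𝕃₂ Σ) → ∃₂ λ p q → proj₁ p ≪* proj₁ q × f p ≼ f q
  good β barrier f with em {∃₂ λ p q → proj₁ p ≪* proj₁ q × f p ≼ f q}
  ... | yes pair = pair
  ... | no ¬pair = ⊥-elim (Arrays.Descent.no-bad-array em Σ (Shift β) (shift-front β-front)
          (pigeonhole-Maybe em Σ↔Fin)
          (record { dom = λ _ → true ; val = proj₁ shifted ; unb = λ m → suc m , n<1+n m , _ ; bad = proj₂ shifted }))
    where
    β-front = barrier⇒front barrier

    -- f may depend on the proof of s ∈ β; excluded middle selects one.
    f̂ : List ℕ → 𝕃₂ Σ
    f̂ s with em {β s}
    ... | yes s∈β = f (s , s∈β)
    -- Over an empty alphabet there are no constraints, so the default is taken from `f` at the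
    -- member of `β` that starts the identity sequence.
    ... | no  _   = let (s₀ , s₀∈β , _) = Barrier.meets barrier id id in f (s₀ , s₀∈β)

    f̂-bad : Bad β _≼_ (λ _ → true) f̂
    f̂-bad {x} {u} {y} {w} _ _ gs gt with em {β (x ∷ u)} | em {β (u ++ y ∷ w)}
    ... | yes s∈β | yes t∈β = λ le → ¬pair ((_ , s∈β) , (_ , t∈β) , ++⇒≪ u , λ {v} → le {v})
    ... | no  s∉β | _       = contradiction gs s∉β
    ... | yes _   | no t∉β  = contradiction gt t∉β

    shifted = shift-bad em β-front {f = f̂} f̂-bad
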